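{- For every integer $n\ge 1$, $$c_n=(-1)^n(2n+1)!!\,\det(A_n),$$ where $A_n$ is the $n\times n$ matrix with entries, for $1\le i,j\le n$, $$(A_n)_{ij}=\begin{cases}\dfrac{1}{i+j}, & j-i\le 1,\\ 0, & \text{otherwise.}\end{cases}$$
   Context: $(2n+1)!!=1\cdot 3\cdot 5\cdots(2n+1)$. Let $\mathcal H=L^2([0,1],dx)$ (complex-valued functions, Lebesgue measure) with its norm $\|\cdot\|$. The sequence $(c_n)_{n\ge 0}$ is defined recursively: $c_0=1$, and, writing $p_n(x)=c_0+c_1x+\ldots+c_nx^n$, for each $n\ge 0$ the number $c_{n+1}$ is the unique complex number $c$ for which the norm $\|p_n(x)+c\,x^{n+1}\|$ is minimal among all $c\in\mathbb C$. Equivalently, $c_0=1$ and $\frac{c_0}{n+1}+\frac{c_1}{n+2}+\ldots+\frac{c_n}{2n+1}=0$ for all $n\ge 1$. -}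

module Defs where

open import Algebra.Apartness.Bundles using (HeytingField)
open import Algebra.Bundles using (CommutativeRing; Semiring)
import Algebra.Definitions.RawSemiring as RawSemiringDefs
open import Algebra.Definitions using (Invertible)
import Algebra.Properties.Ring as RingProperties
import Algebra.Apartness.Properties.HeytingCommutativeRing as HeytingProperties
open import Data.Bool.Base using (if_then_else_)
open import Data.Empty using (⊥-elim)
open import Data.Fin.Base using (Fin; zero; suc; toℕ; punchIn)
open import Data.List.Base using (List; []; _∷_; _++_; [_]; map; replicate)
open import Data.Nat.Base as ℕ using (ℕ; zero; suc; NonZero; _≤ᵇ_)
open import Data.Product.Base using (∃-syntax; _×_; _,_; proj₁; proj₂)
open import Data.Sum.Base using (_⊎_; inj₁; inj₂)
open import Level using (Level; _⊔_) renaming (suc to lsuc)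
open import Relation.Binary.Core using (Rel)
open import Relation.Binary.Structures using (IsStrictPartialOrder)
open import Relation.Nullary using (¬_)

-- The real numbers, characterised as an Archimedean, Cauchy complete
-- ordered field.  The axioms are the constructive ones (no decidable
-- order, inverses for elements apart from zero); with excluded middle
-- they amount to the usual classical axioms.

record Reals (c ℓ₁ ℓ₂ : Level) : Set (lsuc (c ⊔ ℓ₁ ⊔ ℓ₂)) where
  infix 4 _<_ _≤_
  field
    heytingField : HeytingField c ℓ₁ ℓ₂

  open HeytingField heytingField public

  commutativeRing : CommutativeRing c ℓ₁
  commutativeRing = record { isCommutativeRing = isCommutativeRing }

  -- n · x is the n-fold sum x + ⋯ + x, and sum is the sum of a finite family.
  open RawSemiringDefs (Semiring.rawSemiring (CommutativeRing.semiring commutativeRing)) public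
    using (_^_; sum) renaming (_×_ to _·_)

  field
    _<_                  : Rel Carrier ℓ₂
    isStrictPartialOrder : IsStrictPartialOrder _≈_ _<_
    <⇒#                  : ∀ {x y} → x < y → x # y
    #⇒<⊎>                : ∀ {x y} → x # y → x < y ⊎ y < x
    +-monoʳ-<            : ∀ x {y z} → y < z → x + y < x + z
    *-pos                : ∀ {x y} → 0# < x → 0# < y → 0# < x * y

  _≤_ : Rel Carrier ℓ₂
  x ≤ y = ¬ (y < x)

  -- ∣ x - y ∣ < ε
  Within : Carrier → Carrier → Carrier → Set ℓ₂
  Within ε x y = (x - y < ε) × (y - x < ε)

  IsCauchy : (ℕ → Carrier) → Set (c ⊔ ℓ₂)
  IsCauchy s = ∀ ε → 0# < ε →
    ∃[ N ] (∀ m n → N ℕ.≤ m → N ℕ.≤ n → Within ε (s m) (s n))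

  _ConvergesTo_ : (ℕ → Carrier) → Carrier → Set (c ⊔ ℓ₂)
  s ConvergesTo l = ∀ ε → 0# < ε →
    ∃[ N ] (∀ n → N ℕ.≤ n → Within ε (s n) l)

  field
    archimedean : ∀ x → ∃[ n ] (x < n · 1#)
    complete    : ∀ s → IsCauchy s → ∃[ l ] (s ConvergesTo l)

module L²[0,1] {c ℓ₁ ℓ₂ : Level} (ℝ : Reals c ℓ₁ ℓ₂) where
  open Reals ℝ hiding (zero)

  private
    module CR = CommutativeRing commutativeRing
    module R = RingProperties CR.ring
    module SPO = IsStrictPartialOrder isStrictPartialOrder

    <-resp₂ : ∀ {x x′ y y′} → x ≈ x′ → y ≈ y′ → x < y → x′ < y′
    <-resp₂ p q x<y = SPO.<-respˡ-≈ p (SPO.<-respʳ-≈ q x<y)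

    0<1 : 0# < 1#
    0<1 with #⇒<⊎> (HeytingProperties.1#0 (HeytingField.heytingCommutativeRing heytingField))
    ... | inj₂ 0<1 = 0<1
    ... | inj₁ 1<0 = ⊥-elim (SPO.irrefl CR.refl (SPO.trans 0<1′ 1<0))
      where
      0<-1 : 0# < - 1#
      0<-1 = <-resp₂ (CR.-‿inverseˡ 1#) (CR.+-identityʳ (- 1#)) (+-monoʳ-< (- 1#) 1<0)
      0<1′ : 0# < 1#
      0<1′ = SPO.<-respʳ-≈
        (CR.trans (R.-1*x≈-x (- 1#)) (R.-‿involutive 1#)) (*-pos 0<-1 0<-1)

  0<suc : ∀ n → 0# < suc n · 1#
  0<suc zero    = SPO.<-respʳ-≈ (CR.sym (CR.+-identityʳ 1#)) 0<1
  0<suc (suc n) = SPO.trans 0<1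
    (SPO.<-respˡ-≈ (CR.+-identityʳ 1#) (+-monoʳ-< 1# (0<suc n)))

  private
    suc-invertible : ∀ n → Invertible _≈_ 1# _*_ (suc n · 1# - 0#)
    suc-invertible n = #⇒invertible (#-sym (<⇒# (0<suc n)))

  1/_ : (n : ℕ) → .{{NonZero n}} → Carrier
  1/ suc n = proj₁ (suc-invertible n)

  1/-inverseˡ : ∀ n .{{_ : NonZero n}} → (1/ n) * (n · 1#) ≈ 1#
  1/-inverseˡ (suc n) =
    CR.trans (CR.*-congˡ (CR.sym n-0≈n)) (proj₁ (proj₂ (suc-invertible n)))
    where
    n-0≈n : suc n · 1# - 0# ≈ suc n · 1#
    n-0≈n = HeytingProperties.x-0≈x (HeytingField.heytingCommutativeRing heytingField) _

  infix  6 _+i_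
  record ℂ : Set c where
    constructor _+i_
    field
      re im : Carrier
  open ℂ public

  infix  4 _≈ᶜ_
  infixl 6 _+ᶜ_ _-ᶜ_
  infixl 7 _*ᶜ_

  _≈ᶜ_ : ℂ → ℂ → Set ℓ₁
  z ≈ᶜ w = (re z ≈ re w) × (im z ≈ im w)

  _+ᶜ_ _-ᶜ_ _*ᶜ_ : ℂ → ℂ → ℂ
  z +ᶜ w = (re z + re w) +i (im z + im w)
  z -ᶜ w = (re z - re w) +i (im z - im w)
  z *ᶜ w = (re z * re w - im z * im w) +i (re z * im w + im z * re w)

  conj : ℂ → ℂ
  conj z = re z +i (- im z)

  fromℝ : Carrier → ℂ
  fromℝ x = x +i 0#

  0ᶜ 1ᶜ : ℂ
  0ᶜ = fromℝ 0#
  1ᶜ = fromℝ 1#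

  -- The list a₀ ∷ a₁ ∷ … ∷ [] stands for a₀ + a₁ x + ….
  Poly : Set c
  Poly = List ℂ

  infixl 6 _+ᵖ_
  infixl 7 _*ᵖ_
  infix  8 _x^_

  _x^_ : ℂ → ℕ → Poly
  a x^ n = replicate n 0ᶜ ++ [ a ]

  _+ᵖ_ : Poly → Poly → Poly
  []      +ᵖ q       = q
  (a ∷ p) +ᵖ []      = a ∷ p
  (a ∷ p) +ᵖ (b ∷ q) = (a +ᶜ b) ∷ (p +ᵖ q)

  _*ᵖ_ : Poly → Poly → Poly
  []      *ᵖ q = []
  (a ∷ p) *ᵖ q = map (a *ᶜ_) q +ᵖ (0ᶜ ∷ (p *ᵖ q))

  eval : Poly → ℂ → ℂ
  eval []      z = 0ᶜ
  eval (a ∷ p) z = a +ᶜ z *ᶜ eval p z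

  -- The antiderivative of xᵏ⁻¹ p(x) vanishing at 0, divided by xᵏ.
  antiderivativeFrom : (k : ℕ) → .{{NonZero k}} → Poly → Poly
  antiderivativeFrom k []      = []
  antiderivativeFrom k (a ∷ p) = (fromℝ (1/ k) *ᶜ a) ∷ antiderivativeFrom (suc k) p

  antiderivative : Poly → Poly
  antiderivative p = 0ᶜ ∷ antiderivativeFrom 1 p

  -- On polynomials the Lebesgue integral is given by the fundamental
  -- theorem of calculus.
  ∫₀¹ : Poly → ℂ
  ∫₀¹ p = eval (antiderivative p) 1ᶜ -ᶜ eval (antiderivative p) 0ᶜ

  -- For real x, the complex conjugate of q(x) is (map conj q)(x).
  ⟨_,_⟩ : Poly → Poly → ℂ
  ⟨ p , q ⟩ = ∫₀¹ (p *ᵖ map conj q)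

  -- ‖ p ‖ is the nonnegative square root of ∫₀¹ ∣ p(x) ∣² dx.
  record IsL²Norm (‖_‖ : Poly → Carrier) : Set (c ⊔ ℓ₁ ⊔ ℓ₂) where
    field
      nonNegative : ∀ p → 0# ≤ ‖ p ‖
      square      : ∀ p → fromℝ (‖ p ‖ * ‖ p ‖) ≈ᶜ ⟨ p , p ⟩

  partialSum : (ℕ → ℂ) → ℕ → Poly
  partialSum a zero    = a 0 x^ 0
  partialSum a (suc n) = partialSum a n +ᵖ a (suc n) x^ suc n

  IsMinimizer : (ℂ → Carrier) → ℂ → Set (c ⊔ ℓ₂)
  IsMinimizer f z = ∀ w → f z ≤ f w

  -- The recursive definition of (cₙ).  Each minimizer is unique, so these
  -- conditions determine the sequence.
  record IsMinimizingSequence (‖_‖ : Poly → Carrier) (a : ℕ → ℂ) : Set (c ⊔ ℓ₁ ⊔ ℓ₂) where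
    field
      initial : a 0 ≈ᶜ 1ᶜ
      minimal : ∀ n →
        IsMinimizer (λ z → ‖ partialSum a n +ᵖ z x^ suc n ‖) (a (suc n))

  Matrix : ℕ → Set c
  Matrix n = Fin n → Fin n → Carrier

  det : ∀ {n} → Matrix n → Carrier
  det {zero}  M = 1#
  det {suc n} M = sum λ j →
    (- 1#) ^ toℕ j * M zero j * det (λ i k → M (suc i) (punchIn j k))

  -- The entry in row i and column j (counted from 1); j ≤ i + 1 is j - i ≤ 1.
  entry : (i j : ℕ) → .{{NonZero (i ℕ.+ j)}} → Carrier
  entry i j = if j ≤ᵇ suc i then 1/ (i ℕ.+ j) else 0#

  A : ∀ n → Matrix n
  A n i j = entry (suc (toℕ i)) (suc (toℕ j))

[2_+1]!! : ℕ → ℕ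
[2 zero  +1]!! = 1
[2 suc n +1]!! = [2 n +1]!! ℕ.* (2 ℕ.* suc n ℕ.+ 1)

-- Minimality of cₘ says that Σ_{j ≤ m} cⱼ / (m + j + 1) = 0: split into real
-- and imaginary parts, ‖pₘ₋₁ + z xᵐ‖² is a sum of two quadratics with leading
-- coefficient 1/(2m+1), each of which is minimized only at its critical point.
-- These equations form a Hessenberg system whose superdiagonal has product
-- 1/(2n+1)!!.  Eliminating the first row and merging the first two columns,
-- weighted by the unknowns, gives a system of the same shape, so by induction
-- c₀ det(A n) = (-1)ⁿ cₙ / (2n+1)!!.

module Submission where

open import Defs
open import Algebra.Bundles using (CommutativeRing; CommutativeMonoid)
import Algebra.Apartness.Properties.HeytingCommutativeRing as HeytingProperties
import Algebra.Properties.CommutativeMonoid.Sum as CommutativeMonoidSum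
import Algebra.Properties.Ring as RingProperties
import Algebra.Properties.AbelianGroup as AbelianGroupProperties
import Algebra.Properties.Semiring.Mult as SemiringMult
import Algebra.Properties.Semiring.Sum as SemiringSum
import Algebra.Solver.Ring.NaturalCoefficients.Default as NaturalSolver
open import Data.Bool.Base using (true; false; T; if_then_else_)
open import Data.Empty using (⊥; ⊥-elim)
open import Data.Fin.Base using (Fin; zero; suc; toℕ; punchIn)
open import Data.Fin.Properties using (toℕ<n)
open import Data.List.Base using ([]; _∷_; map)
open import Data.Nat.Base as ℕ using (ℕ; zero; suc; _≤ᵇ_; z≤n; s≤s) renaming (_≤_ to _≤ⁿ_; _<_ to _<ⁿ_)
import Data.Nat.Properties as ℕₚ
open import Data.Product.Base using (_,_; proj₁; proj₂)
open import Data.Sum.Base using (_⊎_; inj₁; inj₂)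
open import Function.Base using (_∘_)
open import Level using (Level)
open import Relation.Binary.PropositionalEquality.Core as ≡ using (_≡_)
import Relation.Binary.Reasoning.Setoid as SetoidReasoning
open import Relation.Binary.Structures using (IsStrictPartialOrder)
open import Relation.Nullary using (¬_)

module SumSnoc {a ℓ} (M : CommutativeMonoid a ℓ) where
  open CommutativeMonoid M renaming (ε to 0#; _∙_ to _+_)
  open CommutativeMonoidSum M using (sum)

  -- `sum` unfolds at its first term, whereas partial sums and double factorials grow at the last
  -- one. A general commutative monoid covers both sums and products.
  sum-snoc : ∀ n (f : ℕ → Carrier) →
    sum {suc n} (f ∘ toℕ) ≈ sum {n} (f ∘ toℕ) + f n
  sum-snoc zero    f = comm (f 0) 0#
  sum-snoc (suc n) f =
    trans (∙-congˡ (sum-snoc n (f ∘ suc))) (sym (assoc _ _ _))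

module _ {ℓ ℓ₁ ℓ₂ : Level} (ℝ : Reals ℓ ℓ₁ ℓ₂) where
  open Reals ℝ hiding (zero)
  open L²[0,1] ℝ

  private
    module CR = CommutativeRing commutativeRing
    module SPO = IsStrictPartialOrder isStrictPartialOrder
    module HP = HeytingProperties heytingCommutativeRing
  open RingProperties CR.ring using (-‿distribˡ-*; -‿distribʳ-*; -‿involutive; -1*x≈-x)
  open AbelianGroupProperties CR.+-abelianGroup using (xyx⁻¹≈y; inverseˡ-unique)
  open SemiringMult CR.semiring using (×1-homo-*)
  open SemiringSum CR.semiring using (sum-cong-≋; ∑-distrib-+; *-distribˡ-sum; sum-replicate-zero)
  open CommutativeMonoidSum CR.*-commutativeMonoid using () renaming (sum to product)
  private
    module +-Sum = SumSnoc CR.+-commutativeMonoid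
    module *-Product = SumSnoc CR.*-commutativeMonoid
  open NaturalSolver CR.commutativeSemiring using (solve; _:=_; _:+_; _:*_; con)
  open SetoidReasoning CR.setoid

  -- Order

  <-resp : ∀ {x x′ y y′} → x ≈ x′ → y ≈ y′ → x < y → x′ < y′
  <-resp p q x<y = SPO.<-respˡ-≈ p (SPO.<-respʳ-≈ q x<y)

  <-connex : ∀ {x y} → ¬ (x < y) → ¬ (y < x) → x ≈ y
  <-connex {x} {y} x≮y y≮x = proj₁ (tight x y) λ x#y → case′ (#⇒<⊎> x#y)
    where
    case′ : x < y ⊎ y < x → ⊥
    case′ (inj₁ x<y) = x≮y x<y
    case′ (inj₂ y<x) = y≮x y<x

  +-monoˡ-< : ∀ z {x y} → x < y → x + z < y + z
  +-monoˡ-< z x<y = <-resp (+-comm z _) (+-comm z _) (+-monoʳ-< z x<y)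

  x<y⇒0<y-x : ∀ {x y} → x < y → 0# < y - x
  x<y⇒0<y-x {x} x<y = SPO.<-respˡ-≈ (-‿inverseʳ x) (+-monoˡ-< (- x) x<y)

  x+[y-x]≈y : ∀ x y → x + (y - x) ≈ y
  x+[y-x]≈y x y = trans (sym (+-assoc x y (- x))) (xyx⁻¹≈y x y)

  *-monoˡ-<-pos : ∀ {x y z} → 0# < z → x < y → z * x < z * y
  *-monoˡ-<-pos {x} {y} {z} 0<z x<y = <-resp
    (+-identityʳ (z * x))
    (trans (sym (distribˡ z x (y - x))) (*-congˡ (x+[y-x]≈y x y)))
    (+-monoʳ-< (z * x) (*-pos 0<z (x<y⇒0<y-x x<y)))

  -x*-y≈x*y : ∀ x y → - x * - y ≈ x * y
  -x*-y≈x*y x y = trans (sym (-‿distribˡ-* x (- y)))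
    (trans (-‿cong (sym (-‿distribʳ-* x y))) (-‿involutive (x * y)))

  x#0⇒0<x*x : ∀ {x} → x # 0# → 0# < x * x
  x#0⇒0<x*x {x} x#0 with #⇒<⊎> x#0
  ... | inj₂ 0<x = *-pos 0<x 0<x
  ... | inj₁ x<0 = SPO.<-respʳ-≈ (-x*-y≈x*y x x) (*-pos 0<-x 0<-x)
    where
    0<-x : 0# < - x
    0<-x = SPO.<-respʳ-≈ (+-identityˡ (- x)) (x<y⇒0<y-x x<0)

  -- Signs cannot be decided, so given `y * y < x * x` the case `x < y` is refuted first; then
  -- `y ≈ x` by tightness, and irreflexivity gives the contradiction.
  square-mono-≤ : ∀ {x y} → 0# ≤ x → x ≤ y → x * x ≤ y * y
  square-mono-≤ {x} {y} 0≤x x≤y y²<x² = SPO.irrefl (*-cong y≈x y≈x) y²<x²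
    where
    x≮y : ¬ (x < y)
    x≮y x<y = SPO.irrefl refl (SPO.trans 0<y² (SPO.<-respʳ-≈ x²≈0 y²<x²))
      where
      0≮x : ¬ (0# < x)
      0≮x 0<x = SPO.irrefl refl (SPO.trans y²<x²
        (SPO.trans (*-monoˡ-<-pos 0<x x<y)
          (SPO.<-respˡ-≈ (*-comm y x) (*-monoˡ-<-pos (SPO.trans 0<x x<y) x<y))))
      x≈0 : x ≈ 0#
      x≈0 = <-connex 0≤x 0≮x
      x²≈0 : x * x ≈ 0#
      x²≈0 = trans (*-congʳ x≈0) (zeroˡ x)
      0<y² : 0# < y * y
      0<y² = *-pos (SPO.<-respˡ-≈ x≈0 x<y) (SPO.<-respˡ-≈ x≈0 x<y)
    y≈x : y ≈ x
    y≈x = <-connex x≤y x≮y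

  -- α + 2βx + κx², in the shape in which ⟨ p + r , p + r ⟩ expands.
  quadratic : (α β κ x : Carrier) → Carrier
  quadratic α β κ x = α + β * x + (x * β + x * (κ * x))

  -- Expanding the quadratic at its critical point leaves no linear term.
  quadratic-minimizer : ∀ α β {κ N x} → 0# < N → κ * N ≈ 1# →
    (∀ y → quadratic α β κ x ≤ quadratic α β κ y) → β + κ * x ≈ 0#
  quadratic-minimizer α β {κ} {N} {x} 0<N κN≈1 min = begin
    β + κ * x ≈⟨ +-congˡ (*-congˡ x≈y) ⟩
    β + κ * y ≈⟨ critical ⟩
    0# ∎
    where
    -- Since `N` inverts `κ`, this is the critical point -β/κ.
    y = - (N * β)

    critical : β + κ * y ≈ 0#
    critical = begin
      β + κ * - (N * β)   ≈⟨ +-congˡ (sym (-‿distribʳ-* κ (N * β))) ⟩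
      β - κ * (N * β)     ≈⟨ +-congˡ (-‿cong (trans (sym (*-assoc κ N β))
                                (trans (*-congʳ κN≈1) (*-identityˡ β)))) ⟩
      β - β               ≈⟨ -‿inverseʳ β ⟩
      0# ∎

    κ#0 : κ # 0#
    κ#0 = HP.invertibleʳ⇒# (N , trans (*-congʳ (HP.x-0≈x κ)) κN≈1)

    -- `κ` equals κ²N, a product of positive numbers.
    0<κ : 0# < κ
    0<κ = SPO.<-respʳ-≈
      (trans (*-assoc κ κ N) (trans (*-congˡ κN≈1) (*-identityʳ κ)))
      (*-pos (x#0⇒0<x*x κ#0) 0<N)

    expand : ∀ t → quadratic α β κ (y + t) ≈ quadratic α β κ y + κ * (t * t)
    expand t = begin
      quadratic α β κ (y + t)
        ≈⟨ solve 5 (λ α β κ y t →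
             α :+ β :* (y :+ t) :+ ((y :+ t) :* β :+ (y :+ t) :* (κ :* (y :+ t))) :=
             α :+ β :* y :+ (y :* β :+ y :* (κ :* y)) :+ κ :* (t :* t)
               :+ (t :+ t) :* (β :+ κ :* y)) refl α β κ y t ⟩
      quadratic α β κ y + κ * (t * t) + (t + t) * (β + κ * y)
        ≈⟨ +-congˡ (trans (*-congˡ critical) (zeroʳ _)) ⟩
      quadratic α β κ y + κ * (t * t) + 0#
        ≈⟨ +-identityʳ _ ⟩
      quadratic α β κ y + κ * (t * t) ∎

    quadratic-cong : ∀ {u v} → u ≈ v → quadratic α β κ u ≈ quadratic α β κ v
    quadratic-cong u≈v = +-cong (+-congˡ (*-congˡ u≈v))
      (+-cong (*-congʳ u≈v) (*-cong u≈v (*-congˡ u≈v)))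

    x≈y : x ≈ y
    -- If `x # y`, the value at `x` exceeds the value at `y` by κ(x-y)² > 0, against minimality at
    -- `x`.
    x≈y = proj₁ (tight x y) λ x#y → min y (<-resp
      (+-identityʳ _)
      (trans (sym (expand (x - y))) (quadratic-cong (x+[y-x]≈y y x)))
      (+-monoʳ-< (quadratic α β κ y) (*-pos 0<κ (x#0⇒0<x*x (x-y#0 x#y)))))
      where
      x-y#0 : x # y → x - y # 0#
      x-y#0 x#y with #⇒invertible x#y
      ... | z , zˡ , _ = HP.invertibleˡ⇒# (z , trans (*-congˡ (HP.x-0≈x (x - y))) zˡ)

  sum-zero : ∀ {n} (f : Fin n → Carrier) → (∀ i → f i ≈ 0#) → sum f ≈ 0#
  sum-zero {n} f f≈0 = trans (sum-cong-≋ f≈0) (sum-replicate-zero n)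

  -- Determinants

  det-cong : ∀ {n} {M N : Matrix n} → (∀ i j → M i j ≈ N i j) → det M ≈ det N
  det-cong {zero}  M≈N = refl
  det-cong {suc n} M≈N = sum-cong-≋ λ j →
    *-cong (*-congˡ {(- 1#) ^ toℕ j} (M≈N zero j)) (det-cong λ i k → M≈N (suc i) (punchIn j k))

  -- This is linearity in the first column, while `det` expands along the first row. The column-zero
  -- term splits through its entry, as its minor avoids that column; every other minor still has it
  -- as first column, so induction applies.
  det-linear : ∀ {n} (L M N : Matrix (suc n)) {y z} →
    (∀ i → L i zero ≈ y * M i zero + z * N i zero) →
    (∀ i j → L i (suc j) ≈ M i (suc j)) →
    (∀ i j → L i (suc j) ≈ N i (suc j)) →
    det L ≈ y * det M + z * det N
  det-linear {n} L M N {y} {z} L₀ L≈M L≈N = begin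
    det L
      ≈⟨ sum-cong-≋ (terms L M N L₀ L≈M L≈N) ⟩
    sum (λ j → y * term M j + z * term N j)
      ≈⟨ ∑-distrib-+ (λ j → y * term M j) (λ j → z * term N j) ⟩
    sum (λ j → y * term M j) + sum (λ j → z * term N j)
      ≈⟨ +-cong (*-distribˡ-sum y (term M)) (*-distribˡ-sum z (term N)) ⟨
    y * det M + z * det N ∎
    where
    minor : ∀ {n} → Matrix (suc n) → Fin (suc n) → Matrix n
    minor P j i k = P (suc i) (punchIn j k)

    term : ∀ {n} → Matrix (suc n) → Fin (suc n) → Carrier
    term P j = (- 1#) ^ toℕ j * P zero j * det (minor P j)

    -- The size is quantified anew because a column `suc j` forces it to be at least two; the
    -- pattern `suc n` exposes this, so that the minors have a first column.
    terms : ∀ {n} (L M N : Matrix (suc n)) →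
      (∀ i → L i zero ≈ y * M i zero + z * N i zero) →
      (∀ i j → L i (suc j) ≈ M i (suc j)) →
      (∀ i j → L i (suc j) ≈ N i (suc j)) →
      ∀ j → term L j ≈ y * term M j + z * term N j
    terms L M N L₀ L≈M L≈N zero = begin
      1# * L zero zero * det (minor L zero)
        ≈⟨ *-congʳ (*-congˡ (L₀ zero)) ⟩
      1# * (y * M zero zero + z * N zero zero) * det (minor L zero)
        ≈⟨ solve 6 (λ s y z m n d → s :* (y :* m :+ z :* n) :* d :=
             y :* (s :* m :* d) :+ z :* (s :* n :* d)) refl
             1# y z (M zero zero) (N zero zero) (det (minor L zero)) ⟩
      y * (1# * M zero zero * det (minor L zero)) + z * (1# * N zero zero * det (minor L zero))
        ≈⟨ +-cong (*-congˡ (*-congˡ (det-cong λ i → L≈M (suc i))))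
                  (*-congˡ (*-congˡ (det-cong λ i → L≈N (suc i)))) ⟩
      y * term M zero + z * term N zero ∎
    terms {suc n} L M N L₀ L≈M L≈N (suc j) = begin
      s * L zero (suc j) * det (minor L (suc j))
        ≈⟨ *-congˡ (det-linear (minor L (suc j)) (minor M (suc j)) (minor N (suc j))
             (L₀ ∘ suc) (λ i k → L≈M (suc i) (punchIn j k)) (λ i k → L≈N (suc i) (punchIn j k))) ⟩
      s * L zero (suc j) * (y * det (minor M (suc j)) + z * det (minor N (suc j)))
        ≈⟨ solve 6 (λ s l y z d e → s :* l :* (y :* d :+ z :* e) :=
             y :* (s :* l :* d) :+ z :* (s :* l :* e)) refl
             s (L zero (suc j)) y z (det (minor M (suc j))) (det (minor N (suc j))) ⟩
      y * (s * L zero (suc j) * det (minor M (suc j))) + z * (s * L zero (suc j) * det (minor N (suc j)))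
        ≈⟨ +-cong (*-congˡ (*-congʳ (*-congˡ (L≈M zero j))))
                  (*-congˡ (*-congʳ (*-congˡ (L≈N zero j)))) ⟩
      y * term M (suc j) + z * term N (suc j) ∎
      where s = (- 1#) ^ toℕ (suc j)

  -- Hessenberg systems of linear equations.

  truncate : (ℕ → ℕ → Carrier) → ∀ n → Matrix n
  truncate B n i j = B (toℕ i) (toℕ j)

  IsHessenberg : (ℕ → ℕ → Carrier) → Set ℓ₁
  IsHessenberg B = ∀ i j → suc i <ⁿ j → B i j ≈ 0#

  -- For a Hessenberg array the entries beyond column `suc i` vanish, so the finite sum is the whole
  -- row. The last row of a square truncation reaches one column outside it, hence infinite arrays.
  Annihilates : (ℕ → ℕ → Carrier) → (ℕ → Carrier) → Set ℓ₁
  Annihilates B x = ∀ i → sum {suc (suc i)} (λ j → B i (toℕ j) * x (toℕ j)) ≈ 0#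

  superdiagonalProduct : (ℕ → ℕ → Carrier) → ℕ → Carrier
  superdiagonalProduct B n = product {n} (λ i → B (toℕ i) (suc (toℕ i)))

  -- The weights are those with which the two columns enter the product of `B` and `x`, so the
  -- equations of the later rows survive the merge.
  contract : (ℕ → Carrier) → (ℕ → ℕ → Carrier) → ℕ → ℕ → Carrier
  contract x B i zero    = x 1 * B (suc i) 1 + x 0 * B (suc i) 0
  contract x B i (suc j) = B (suc i) (suc (suc j))

  -- The merged column gets the unknown 1, since its weights x 0 and x 1 are
  -- already part of its entries.
  contractVector : (ℕ → Carrier) → ℕ → Carrier
  contractVector x zero    = 1#
  contractVector x (suc j) = x (suc (suc j))

  contract-isHessenberg : ∀ {B} x → IsHessenberg B → IsHessenberg (contract x B)
  contract-isHessenberg x hess i (suc j) i<j = hess (suc i) (suc (suc j)) (s≤s i<j)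

  contract-annihilates : ∀ B x → Annihilates B x →
    Annihilates (contract x B) (contractVector x)
  contract-annihilates B x ann i = trans
    (solve 5 (λ x₀ x₁ b₀ b₁ r → (x₁ :* b₁ :+ x₀ :* b₀) :* con 1 :+ r :=
       b₀ :* x₀ :+ (b₁ :* x₁ :+ r)) refl (x 0) (x 1) (B (suc i) 0) (B (suc i) 1)
       (sum {suc i} (λ j → B (suc i) (suc (suc (toℕ j))) * x (suc (suc (toℕ j))))))
    (ann (suc i))

  row₀-solution : ∀ B x → Annihilates B x → B 0 0 * x 0 ≈ - 1# * (B 0 1 * x 1)
  row₀-solution B x ann = begin
    B 0 0 * x 0            ≈⟨ inverseˡ-unique _ _ (ann 0) ⟩
    - (B 0 1 * x 1 + 0#)   ≈⟨ -‿cong (+-identityʳ _) ⟩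
    - (B 0 1 * x 1)        ≈⟨ -1*x≈-x _ ⟨
    - 1# * (B 0 1 * x 1)   ∎

  -- A division-free form of Cramer's rule. The first unknown stays free: the induction uses 1, and
  -- the theorem uses the real and imaginary parts of the first coefficient.
  hessenberg-solution : ∀ n B x → IsHessenberg B → Annihilates B x →
    x 0 * det (truncate B (suc n)) ≈
      (- 1#) ^ suc n * superdiagonalProduct B (suc n) * x (suc n)
  hessenberg-solution zero B x hess ann = begin
    x 0 * (1# * B 0 0 * 1# + 0#)
      ≈⟨ solve 2 (λ x₀ b → x₀ :* (con 1 :* b :* con 1 :+ con 0) := b :* x₀) refl (x 0) (B 0 0) ⟩
    B 0 0 * x 0
      ≈⟨ row₀-solution B x ann ⟩
    - 1# * (B 0 1 * x 1)
      ≈⟨ solve 3 (λ m b x₁ → m :* (b :* x₁) := m :* con 1 :* (b :* con 1) :* x₁) refl (- 1#) (B 0 1) (x 1) ⟩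
    (- 1#) ^ 1 * (B 0 1 * 1#) * x 1 ∎
  hessenberg-solution (suc n) B x hess ann = begin
    -- The first row has at most two nonzero entries. `U` and `V` are their minors: they differ only
    -- in the first column, which comes from column 1 of `B` in `U` and from column 0 in `V`.
    x 0 * (1# * B 0 0 * det U + ((- 1#) ^ 1 * B 0 1 * det V + sum rest))
      ≈⟨ *-congˡ (+-congˡ (trans (+-congˡ rest≈0) (+-identityʳ _))) ⟩
    x 0 * (1# * B 0 0 * det U + (- 1#) ^ 1 * B 0 1 * det V)
      ≈⟨ solve 6 (λ x₀ b₀ u m b₁ v →
           x₀ :* (con 1 :* b₀ :* u :+ m :* con 1 :* b₁ :* v) :=
           b₀ :* x₀ :* u :+ m :* (b₁ :* (x₀ :* v))) refl (x 0) (B 0 0) (det U) (- 1#) (B 0 1) (det V) ⟩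
    B 0 0 * x 0 * det U + - 1# * (B 0 1 * (x 0 * det V))
      -- The first equation trades the corner entry for the superdiagonal one, so that
      -- `- 1# * B 0 1` factors out and the two minors combine into the contracted determinant.
      ≈⟨ +-congʳ (*-congʳ (row₀-solution B x ann)) ⟩
    - 1# * (B 0 1 * x 1) * det U + - 1# * (B 0 1 * (x 0 * det V))
      ≈⟨ solve 6 (λ m b x₁ u x₀ v →
           m :* (b :* x₁) :* u :+ m :* (b :* (x₀ :* v)) :=
           m :* b :* (x₁ :* u :+ x₀ :* v)) refl (- 1#) (B 0 1) (x 1) (det U) (x 0) (det V) ⟩
    - 1# * B 0 1 * (x 1 * det U + x 0 * det V)
      ≈⟨ *-congˡ (det-linear (truncate C (suc n)) U V
           (λ _ → refl) (λ _ _ → refl) (λ _ _ → refl)) ⟨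
    - 1# * B 0 1 * det (truncate C (suc n))
      -- The inserted `1#` is the first unknown of the contracted system.
      ≈⟨ *-congˡ (*-identityˡ _) ⟨
    - 1# * B 0 1 * (1# * det (truncate C (suc n)))
      ≈⟨ *-congˡ (hessenberg-solution n C (contractVector x)
           (contract-isHessenberg x hess) (contract-annihilates B x ann)) ⟩
    - 1# * B 0 1 * ((- 1#) ^ suc n * superdiagonalProduct C (suc n) * x (suc (suc n)))
      -- The superdiagonal of `C` is definitionally that of `B` without its first entry, which the
      -- factor `B 0 1` restores.
      ≈⟨ solve 5 (λ m b s p y → m :* b :* (s :* p :* y) := m :* s :* (b :* p) :* y) refl
           (- 1#) (B 0 1) ((- 1#) ^ suc n) (superdiagonalProduct C (suc n)) (x (suc (suc n))) ⟩
    (- 1#) ^ suc (suc n) * superdiagonalProduct B (suc (suc n)) * x (suc (suc n)) ∎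
    where
    C = contract x B

    U V : Matrix (suc n)
    U i k = B (suc (toℕ i)) (suc (toℕ k))
    V i k = B (suc (toℕ i)) (toℕ (punchIn (suc zero) k))

    rest : Fin n → Carrier
    rest j = (- 1#) ^ suc (suc (toℕ j)) * B 0 (suc (suc (toℕ j))) *
      det (λ i k → B (suc (toℕ i)) (toℕ (punchIn (suc (suc j)) k)))

    rest≈0 : sum rest ≈ 0#
    rest≈0 = sum-zero rest λ j → trans
      (*-congʳ (trans (*-congˡ (hess 0 (suc (suc (toℕ j))) (s≤s (s≤s z≤n)))) (zeroʳ _)))
      (zeroˡ _)

  -- The inner product in terms of real and imaginary parts

  1/suc-cong : ∀ {m n} → m ≡ n → 1/ suc m ≈ 1/ suc n
  1/suc-cong ≡.refl = refl

  -- Instantiated at `re` and `im`: for real x, the squared modulus of p(x) is the sum of the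
  -- squares of the two parts, so each is treated as a real polynomial.
  module Component (f : ℂ → Carrier)
    (f-+ : ∀ z w → f (z +ᶜ w) ≈ f z + f w) (f-0 : f 0ᶜ ≈ 0#) where

    -- ∫₀¹ xᵏ f(p(x)) dx
    moment : ℕ → Poly → Carrier
    moment k []      = 0#
    moment k (a ∷ p) = (1/ suc k) * f a + moment (suc k) p

    -- ∫₀¹ xᵏ f(p(x)) f(q(x)) dx
    pairing : ℕ → Poly → Poly → Carrier
    pairing k []      q = 0#
    pairing k (a ∷ p) q = f a * moment k q + pairing (suc k) p q

    moment-+ : ∀ k p q → moment k (p +ᵖ q) ≈ moment k p + moment k q
    moment-+ k []      q       = sym (+-identityˡ _)
    moment-+ k (a ∷ p) []      = sym (+-identityʳ _)
    moment-+ k (a ∷ p) (b ∷ q) = trans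
      (+-cong (*-congˡ (f-+ a b)) (moment-+ (suc k) p q))
      (solve 5 (λ r a b m n → r :* (a :+ b) :+ (m :+ n) := r :* a :+ m :+ (r :* b :+ n)) refl
         (1/ suc k) (f a) (f b) (moment (suc k) p) (moment (suc k) q))

    moment-x^ : ∀ k a n → moment k (a x^ n) ≈ (1/ suc (k ℕ.+ n)) * f a
    moment-x^ k a zero    = trans (+-identityʳ _) (*-congʳ (1/suc-cong (≡.sym (ℕₚ.+-identityʳ k))))
    moment-x^ k a (suc n) = begin
      (1/ suc k) * f 0ᶜ + moment (suc k) (a x^ n)
        ≈⟨ +-cong (trans (*-congˡ f-0) (zeroʳ _)) (moment-x^ (suc k) a n) ⟩
      0# + (1/ suc (suc k ℕ.+ n)) * f a
        ≈⟨ +-identityˡ _ ⟩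
      (1/ suc (suc k ℕ.+ n)) * f a
        ≈⟨ *-congʳ (1/suc-cong (≡.sym (ℕₚ.+-suc k n))) ⟩
      (1/ suc (k ℕ.+ suc n)) * f a ∎

    pairing-+ˡ : ∀ k p p′ q → pairing k (p +ᵖ p′) q ≈ pairing k p q + pairing k p′ q
    pairing-+ˡ k []      p′       q = sym (+-identityˡ _)
    pairing-+ˡ k (a ∷ p) []       q = sym (+-identityʳ _)
    pairing-+ˡ k (a ∷ p) (b ∷ p′) q = trans
      (+-cong (*-congʳ (f-+ a b)) (pairing-+ˡ (suc k) p p′ q))
      (solve 5 (λ r a b m n → (a :+ b) :* r :+ (m :+ n) := a :* r :+ m :+ (b :* r :+ n)) refl
         (moment k q) (f a) (f b) (pairing (suc k) p q) (pairing (suc k) p′ q))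

    pairing-+ʳ : ∀ k p q q′ → pairing k p (q +ᵖ q′) ≈ pairing k p q + pairing k p q′
    pairing-+ʳ k []      q q′ = sym (+-identityˡ _)
    pairing-+ʳ k (a ∷ p) q q′ = trans
      (+-cong (*-congˡ (moment-+ k q q′)) (pairing-+ʳ (suc k) p q q′))
      (solve 5 (λ a r s m n → a :* (r :+ s) :+ (m :+ n) := a :* r :+ m :+ (a :* s :+ n)) refl
         (f a) (moment k q) (moment k q′) (pairing (suc k) p q) (pairing (suc k) p q′))

    pairing-x^ˡ : ∀ k a n q → pairing k (a x^ n) q ≈ f a * moment (k ℕ.+ n) q
    pairing-x^ˡ k a zero    q = trans (+-identityʳ _)
      (*-congˡ (reflexive (≡.cong (λ i → moment i q) (≡.sym (ℕₚ.+-identityʳ k)))))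
    pairing-x^ˡ k a (suc n) q = begin
      f 0ᶜ * moment k q + pairing (suc k) (a x^ n) q
        ≈⟨ +-cong (trans (*-congʳ f-0) (zeroˡ _)) (pairing-x^ˡ (suc k) a n q) ⟩
      0# + f a * moment (suc k ℕ.+ n) q
        ≈⟨ +-identityˡ _ ⟩
      f a * moment (suc k ℕ.+ n) q
        ≈⟨ *-congˡ (reflexive (≡.cong (λ i → moment i q) (≡.sym (ℕₚ.+-suc k n)))) ⟩
      f a * moment (k ℕ.+ suc n) q ∎

    pairing-x^ʳ : ∀ k p a n → pairing k p (a x^ n) ≈ moment (k ℕ.+ n) p * f a
    pairing-x^ʳ k []      a n = sym (zeroˡ _)
    pairing-x^ʳ k (b ∷ p) a n = trans
      (+-cong (*-congˡ (moment-x^ k a n)) (pairing-x^ʳ (suc k) p a n))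
      (solve 4 (λ b r a m → b :* (r :* a) :+ m :* a := (r :* b :+ m) :* a) refl
         (f b) (1/ suc (k ℕ.+ n)) (f a) (moment (suc k ℕ.+ n) p))

    -- Both cross terms contain the integral of xᵐ f(p(x)), and the leading coefficient is the
    -- integral of x²ᵐ, namely 1/(2m+1).
    pairing-quadratic : ∀ p z m → pairing 0 (p +ᵖ z x^ m) (p +ᵖ z x^ m) ≈
      quadratic (pairing 0 p p) (moment m p) (1/ suc (m ℕ.+ m)) (f z)
    pairing-quadratic p z m = begin
      pairing 0 (p +ᵖ r) (p +ᵖ r)
        ≈⟨ pairing-+ˡ 0 p r (p +ᵖ r) ⟩
      pairing 0 p (p +ᵖ r) + pairing 0 r (p +ᵖ r)
        ≈⟨ +-cong (pairing-+ʳ 0 p p r) (pairing-+ʳ 0 r p r) ⟩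
      pairing 0 p p + pairing 0 p r + (pairing 0 r p + pairing 0 r r)
        ≈⟨ +-cong (+-congˡ (pairing-x^ʳ 0 p z m))
             (+-cong (pairing-x^ˡ 0 z m p)
               (trans (pairing-x^ˡ 0 z m r) (*-congˡ (moment-x^ m z m)))) ⟩
      quadratic (pairing 0 p p) (moment m p) (1/ suc (m ℕ.+ m)) (f z) ∎
      where r = z x^ m

    moment-partialSum : ∀ k a n → moment k (partialSum a n) ≈
      sum {suc n} (λ j → (1/ suc (k ℕ.+ toℕ j)) * f (a (toℕ j)))
    moment-partialSum k a zero    = trans (moment-x^ k (a 0) 0) (sym (+-identityʳ _))
    moment-partialSum k a (suc n) = begin
      moment k (partialSum a n +ᵖ a (suc n) x^ suc n)
        ≈⟨ moment-+ k (partialSum a n) (a (suc n) x^ suc n) ⟩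
      moment k (partialSum a n) + moment k (a (suc n) x^ suc n)
        ≈⟨ +-cong (moment-partialSum k a n) (moment-x^ k (a (suc n)) (suc n)) ⟩
      sum {suc n} (term ∘ toℕ) + term (suc n)
        ≈⟨ +-Sum.sum-snoc (suc n) term ⟨
      sum {suc (suc n)} (term ∘ toℕ) ∎
      where
      term : ℕ → Carrier
      term j = (1/ suc (k ℕ.+ j)) * f (a j)

  module Re = Component re (λ _ _ → refl) refl
  module Im = Component im (λ _ _ → refl) refl

  re-fromℝ-* : ∀ x z → re (fromℝ x *ᶜ z) ≈ x * re z
  re-fromℝ-* x z = trans (+-congˡ (-‿cong (zeroˡ (im z)))) (HP.x-0≈x _)

  -- At 1 Horner's scheme just adds up the coefficients, and the one at position j has been divided
  -- by k+j+1.
  re-eval-antiderivativeFrom : ∀ k p →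
    re (eval (antiderivativeFrom (suc k) p) 1ᶜ) ≈ Re.moment k p
  re-eval-antiderivativeFrom k []      = refl
  re-eval-antiderivativeFrom k (a ∷ p) = +-cong (re-fromℝ-* (1/ suc k) a)
    (trans (re-fromℝ-* 1# _) (trans (*-identityˡ _) (re-eval-antiderivativeFrom (suc k) p)))

  re-∫₀¹ : ∀ p → re (∫₀¹ p) ≈ Re.moment 0 p
  re-∫₀¹ p = begin
    (0# + re (1ᶜ *ᶜ eval q 1ᶜ)) - (0# + re (0ᶜ *ᶜ eval q 0ᶜ))
      ≈⟨ +-cong (trans (+-identityˡ _) (trans (re-fromℝ-* 1# _) (*-identityˡ _)))
           (-‿cong (trans (+-identityˡ _) (trans (re-fromℝ-* 0# _) (zeroˡ _)))) ⟩
    re (eval q 1ᶜ) - 0#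
      ≈⟨ HP.x-0≈x _ ⟩
    re (eval q 1ᶜ)
      ≈⟨ re-eval-antiderivativeFrom 0 p ⟩
    Re.moment 0 p ∎
    where q = antiderivativeFrom 1 p

  -- The real part of a times the conjugate of b is `re a * re b + im a * im b`, which decouples the
  -- two components.
  moment-*-conj : ∀ k a q → Re.moment k (map (a *ᶜ_) (map conj q)) ≈
    re a * Re.moment k q + im a * Im.moment k q
  moment-*-conj k a [] = sym (trans (+-cong (zeroʳ _) (zeroʳ _)) (+-identityˡ 0#))
  moment-*-conj k a (b ∷ q) = trans
    (+-cong (*-congˡ (+-congˡ re-conj)) (moment-*-conj (suc k) a q))
    (solve 7 (λ r a b a′ b′ m n → r :* (a :* b :+ a′ :* b′) :+ (a :* m :+ a′ :* n) :=
       a :* (r :* b :+ m) :+ a′ :* (r :* b′ :+ n)) refl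
       (1/ suc k) (re a) (re b) (im a) (im b) (Re.moment (suc k) q) (Im.moment (suc k) q))
    where
    re-conj : - (im a * - im b) ≈ im a * im b
    re-conj = trans (-‿cong (sym (-‿distribʳ-* (im a) (im b)))) (-‿involutive _)

  moment-product-conj : ∀ k p q → Re.moment k (p *ᵖ map conj q) ≈
    Re.pairing k p q + Im.pairing k p q
  moment-product-conj k []      q = sym (+-identityˡ 0#)
  moment-product-conj k (a ∷ p) q = begin
    Re.moment k (map (a *ᶜ_) (map conj q) +ᵖ (0ᶜ ∷ p *ᵖ map conj q))
      ≈⟨ Re.moment-+ k (map (a *ᶜ_) (map conj q)) _ ⟩
    -- Prepending a zero coefficient multiplies by x, which raises the order of the moment by one.
    Re.moment k (map (a *ᶜ_) (map conj q)) + ((1/ suc k) * 0# + Re.moment (suc k) (p *ᵖ map conj q))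
      ≈⟨ +-cong (moment-*-conj k a q)
           (+-cong (zeroʳ _) (moment-product-conj (suc k) p q)) ⟩
    re a * Re.moment k q + im a * Im.moment k q +
      (0# + (Re.pairing (suc k) p q + Im.pairing (suc k) p q))
      ≈⟨ solve 4 (λ a b c d → a :+ b :+ (con 0 :+ (c :+ d)) := a :+ c :+ (b :+ d)) refl _ _ _ _ ⟩
    Re.pairing k (a ∷ p) q + Im.pairing k (a ∷ p) q ∎

  re-⟨⟩ : ∀ p q → re ⟨ p , q ⟩ ≈ Re.pairing 0 p q + Im.pairing 0 p q
  re-⟨⟩ p q = trans (re-∫₀¹ (p *ᵖ map conj q)) (moment-product-conj 0 p q)

  -- The normal equations of the minimization.

  module Minimizing (‖_‖ : Poly → Carrier) (isNorm : IsL²Norm ‖_‖)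
    (c : ℕ → ℂ) (isMinimizing : IsMinimizingSequence ‖_‖ c) where
    open IsL²Norm isNorm
    open IsMinimizingSequence isMinimizing

    module _ (n : ℕ) where
      private
        P = partialSum c n
        m = suc n
        κ = 1/ suc (m ℕ.+ m)

        reQuadratic imQuadratic : Carrier → Carrier
        reQuadratic = quadratic (Re.pairing 0 P P) (Re.moment m P) κ
        imQuadratic = quadratic (Im.pairing 0 P P) (Im.moment m P) κ

      norm-square : ∀ z → ‖ P +ᵖ z x^ m ‖ * ‖ P +ᵖ z x^ m ‖ ≈ reQuadratic (re z) + imQuadratic (im z)
      norm-square z = trans (proj₁ (square (P +ᵖ z x^ m)))
        (trans (re-⟨⟩ (P +ᵖ z x^ m) (P +ᵖ z x^ m)) (+-cong (Re.pairing-quadratic P z m) (Im.pairing-quadratic P z m)))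

      quadratic-minimal : ∀ z →
        reQuadratic (re (c m)) + imQuadratic (im (c m)) ≤ reQuadratic (re z) + imQuadratic (im z)
      quadratic-minimal z lt = square-mono-≤ (nonNegative _) (minimal n z)
        (<-resp (sym (norm-square z)) (sym (norm-square (c m))) lt)

      -- Varying the real part alone leaves the imaginary quadratic constant, so `re (c m)`
      -- minimizes the real one. Its critical equation is the real part of the orthogonality of the
      -- partial sum to xᵐ.
      re-normal : Re.moment m (partialSum c m) ≈ 0#
      re-normal = trans (Re.moment-+ m P _)
        (trans (+-congˡ (Re.moment-x^ m (c m) m))
          (quadratic-minimizer (Re.pairing 0 P P) (Re.moment m P) (0<suc (m ℕ.+ m)) (1/-inverseˡ (suc (m ℕ.+ m)))
            λ y lt → quadratic-minimal (y +i im (c m)) (+-monoˡ-< _ lt)))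

      im-normal : Im.moment m (partialSum c m) ≈ 0#
      im-normal = trans (Im.moment-+ m P _)
        (trans (+-congˡ (Im.moment-x^ m (c m) m))
          (quadratic-minimizer (Im.pairing 0 P P) (Im.moment m P) (0<suc (m ℕ.+ m)) (1/-inverseˡ (suc (m ℕ.+ m)))
            λ y lt → quadratic-minimal (re (c m) +i y) (+-monoʳ-< _ lt)))

  -- The matrices A n

  -- `A n` is definitionally `truncate B n`.
  B : ℕ → ℕ → Carrier
  B i j = entry (suc i) (suc j)

  -- The denominator is written as in the moment of order `suc i` of xʲ: row `i`, counted from zero,
  -- is the normal equation of degree `suc i`.
  B-≤ : ∀ i j → j ≤ⁿ suc i → B i j ≈ 1/ suc (suc i ℕ.+ j)
  B-≤ i j j≤1+i = trans
    (if-T (suc j ≤ᵇ suc (suc i)) (ℕₚ.≤⇒≤ᵇ (s≤s j≤1+i)))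
    (1/suc-cong (ℕₚ.+-suc i j))
    where
    if-T : ∀ b {x y} → T b → (if b then x else y) ≈ x
    if-T true _ = refl

  B-isHessenberg : IsHessenberg B
  B-isHessenberg i j 1+i<j = if-¬T (suc j ≤ᵇ suc (suc i)) λ t →
    ℕₚ.<⇒≱ 1+i<j (ℕₚ.≤-pred (ℕₚ.≤ᵇ⇒≤ (suc j) (suc (suc i)) t))
    where
    if-¬T : ∀ b {x y} → ¬ T b → (if b then x else y) ≈ y
    if-¬T true  ¬t = ⊥-elim (¬t _)
    if-¬T false _  = refl

  -- The new superdiagonal entry `B n (suc n)` is 1/(2n+3), inverse to the new factor of the double
  -- factorial.
  [2n+1]!!*superdiagonalProduct≈1 : ∀ n → [2 n +1]!! · 1# * superdiagonalProduct B n ≈ 1#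
  [2n+1]!!*superdiagonalProduct≈1 zero    = trans (*-identityʳ _) (+-identityʳ 1#)
  [2n+1]!!*superdiagonalProduct≈1 (suc n) = begin
    ([2 n +1]!! ℕ.* (2 ℕ.* suc n ℕ.+ 1)) · 1# * superdiagonalProduct B (suc n)
      ≈⟨ *-cong (×1-homo-* [2 n +1]!! (2 ℕ.* suc n ℕ.+ 1))
           (*-Product.sum-snoc n (λ i → B i (suc i))) ⟩
    d * ((2 ℕ.* suc n ℕ.+ 1) · 1#) * (s * B n (suc n))
      ≈⟨ *-cong (*-congˡ (reflexive (≡.cong (_· 1#) 2[1+n]+1)))
           (*-congˡ (B-≤ n (suc n) ℕₚ.≤-refl)) ⟩
    d * e * (s * (1/ suc (suc n ℕ.+ suc n)))
      ≈⟨ solve 4 (λ d e s r → d :* e :* (s :* r) := d :* s :* (r :* e)) refl d e s (1/ suc (suc n ℕ.+ suc n)) ⟩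
    d * s * ((1/ suc (suc n ℕ.+ suc n)) * e)
      ≈⟨ *-cong ([2n+1]!!*superdiagonalProduct≈1 n) (1/-inverseˡ (suc (suc n ℕ.+ suc n))) ⟩
    1# * 1#
      ≈⟨ *-identityˡ 1# ⟩
    1# ∎
    where
    d = [2 n +1]!! · 1#
    e = suc (suc n ℕ.+ suc n) · 1#
    s = superdiagonalProduct B n
    2[1+n]+1 : 2 ℕ.* suc n ℕ.+ 1 ≡ suc (suc n ℕ.+ suc n)
    2[1+n]+1 = ≡.trans (ℕₚ.+-comm (2 ℕ.* suc n) 1)
      (≡.cong (λ k → suc (suc n ℕ.+ k)) (ℕₚ.+-identityʳ (suc n)))

  [-1]^n*[-1]^n≈1 : ∀ n → (- 1#) ^ n * (- 1#) ^ n ≈ 1#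
  [-1]^n*[-1]^n≈1 zero    = *-identityˡ 1#
  [-1]^n*[-1]^n≈1 (suc n) = begin
    - 1# * (- 1#) ^ n * (- 1# * (- 1#) ^ n)
      ≈⟨ solve 2 (λ m s → m :* s :* (m :* s) := m :* m :* (s :* s)) refl (- 1#) ((- 1#) ^ n) ⟩
    - 1# * - 1# * ((- 1#) ^ n * (- 1#) ^ n)
      ≈⟨ *-cong (trans (-x*-y≈x*y 1# 1#) (*-identityˡ 1#)) ([-1]^n*[-1]^n≈1 n) ⟩
    1# * 1#
      ≈⟨ *-identityˡ 1# ⟩
    1# ∎

  -- `hessenberg-solution` is solved for the last unknown: the sign is its own inverse, and the
  -- double factorial inverts the superdiagonal product.
  annihilated-by-B : ∀ n (x : ℕ → Carrier) →
    (∀ i → sum {suc (suc i)} (λ j → (1/ suc (suc i ℕ.+ toℕ j)) * x (toℕ j)) ≈ 0#) →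
    x (suc n) ≈ (- 1#) ^ suc n * ([2 suc n +1]!! · 1#) * (x 0 * det (A (suc n)))
  annihilated-by-B n x eqs = begin
    y                    ≈⟨ trans (*-congʳ (*-identityˡ 1#)) (*-identityˡ y) ⟨
    1# * 1# * y          ≈⟨ *-congʳ (*-cong ([-1]^n*[-1]^n≈1 (suc n)) ([2n+1]!!*superdiagonalProduct≈1 (suc n))) ⟨
    s * s * (d * p) * y  ≈⟨ solve 4 (λ s d p y → s :* s :* (d :* p) :* y := s :* d :* (s :* p :* y)) refl s d p y ⟩
    s * d * (s * p * y)  ≈⟨ *-congˡ (hessenberg-solution n B x B-isHessenberg annihilates) ⟨
    s * d * (x 0 * det (A (suc n))) ∎
    where
    y = x (suc n)
    s = (- 1#) ^ suc n
    d = [2 suc n +1]!! · 1#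
    p = superdiagonalProduct B (suc n)
    annihilates : Annihilates B x
    annihilates i = trans
      (sum-cong-≋ λ j → *-congʳ {x (toℕ j)} (B-≤ i (toℕ j) (ℕₚ.≤-pred (toℕ<n j))))
      (eqs i)

mainTheorem5 : {ℓ ℓ₁ ℓ₂ : Level} (ℝ : Reals ℓ ℓ₁ ℓ₂) →
    let open Reals ℝ
        open L²[0,1] ℝ
    in (‖_‖ : Poly → Carrier) → IsL²Norm ‖_‖ →
       (c : ℕ → ℂ) → IsMinimizingSequence ‖_‖ c →
       ∀ n → 1 ≤ⁿ n →
       c n ≈ᶜ fromℝ ((- 1#) ^ n * ([2 n +1]!! · 1#) * det (A n))
mainTheorem5 ℝ ‖_‖ isNorm c isMinimizing (suc n) _ =
  trans (annihilated-by-B ℝ n (re ∘ c) λ i →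
      trans (sym (Re.moment-partialSum ℝ (suc i) c (suc i))) (re-normal i))
    (*-congˡ (trans (*-congʳ (proj₁ initial)) (*-identityˡ _))) ,
  -- The imaginary parts solve the same system with first unknown 0, hence all vanish.
  trans (annihilated-by-B ℝ n (im ∘ c) λ i →
      trans (sym (Im.moment-partialSum ℝ (suc i) c (suc i))) (im-normal i))
    (trans (*-congˡ (trans (*-congʳ (proj₂ initial)) (zeroˡ _))) (zeroʳ _))
  where
  open Reals ℝ
  open L²[0,1] ℝ
  open IsMinimizingSequence isMinimizing using (initial)
  open Minimizing ℝ ‖_‖ isNorm c isMinimizing
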